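{- For any codes $\mathcal{C}\subseteq 2^{[n]}$ and $\mathcal{D}\subseteq 2^{[n]}$, we have $$\operatorname{odim}(\mathcal{C}\sqcap \mathcal{D}) \le \operatorname{odim}(\mathcal{C}) + \operatorname{odim}(\mathcal{D}),$$ $$\operatorname{cdim}(\mathcal{C}\sqcap \mathcal{D}) \le \operatorname{cdim}(\mathcal{C}) + \operatorname{cdim}(\mathcal{D}),$$ $$\operatorname{bdim}(\mathcal{C}\sqcap \mathcal{D}) \le \operatorname{bdim}(\mathcal{C}) + \operatorname{bdim}(\mathcal{D}).$$
   Context: Write $[n]=\{1,\ldots,n\}$. A code is a set $\mathcal{C}\subseteq 2^{[n]}$. For an ordered (indexed) collection $\mathcal{U} = \{U_1, \ldots, U_n\}$ of sets in $\mathbb{R}^d$, its code is $$\operatorname{code}(\mathcal{U}) = \{\sigma\subseteq [n] \mid \text{there exists } p\in \mathbb{R}^d \text{ such that for all } i\in[n],\ p\in U_i \text{ if and only if } i\in\sigma\},$$ and $\mathcal{U}$ is called a realization of $\operatorname{code}(\mathcal{U})$. By standing convention, all sets in realizations are bounded. An axis-parallel box (box for short) in $\mathbb{R}^d$ is either the empty set or a product $[a_1,b_1]\times\cdots\times[a_d,b_d]$ of nonempty closed intervals (degenerate intervals $a_i=b_i$ allowed). $\operatorname{odim}(\mathcal{C})$ (respectively $\operatorname{cdim}(\mathcal{C})$, $\operatorname{bdim}(\mathcal{C})$) is the minimum $d$ such that $\mathcal{C}$ has a realization in $\mathbb{R}^d$ in which every set is open and convex (respectively closed and convex, a box). The minimum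 over the empty set is $\infty$. The intersection product of two codes $\mathcal{C},\mathcal{D}\subseteq 2^{[n]}$ is $\mathcal{C} \sqcap \mathcal{D} = \{ c_1 \cap c_2 \mid c_1\in \mathcal{C} \text{ and } c_2\in \mathcal{D}\}$. -}

module Defs where

open import Level using (Level; 0ℓ)
open import Algebra.Properties.CommutativeSemigroup using (interchange)
open import Algebra.Bundles using (CommutativeMonoid)
open import Data.Bool.Properties using () renaming (_≟_ to _≟ᵇ_)
open import Data.Fin.Base using (Fin)
open import Data.Fin.Subset using (Subset; _∈_; _∩_)
open import Data.Fin.Subset.Properties using (anySubset?)
open import Data.Nat.Base as ℕ using (ℕ)
open import Data.Nat.Induction using (<-rec)
import Data.Nat.Properties as ℕₚ
open import Data.Product using (∃; ∃₂; ∃-syntax; _×_; _,_)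
open import Data.Rational.Base as ℚ using (ℚ; 0ℚ; 1ℚ; ½)
import Data.Rational.Properties as ℚₚ
open import Data.Sum.Base using (_⊎_; inj₁; inj₂)
open import Data.Vec.Functional using (Vector)
open import Data.Vec.Properties using (≡-dec)
open import Function.Bundles using (_⇔_)
open import Relation.Binary.Construct.Add.Supremum.NonStrict ℕ._≤_ using (_≤⁺_)
open import Relation.Binary.PropositionalEquality
open import Relation.Nullary using (¬_; contradiction)
open import Relation.Nullary.Construct.Add.Supremum using (_⁺; ⊤⁺; [_])
open import Relation.Nullary.Decidable using (_×-dec_)
open import Relation.Unary using (Pred; Decidable; Empty; _≐_)

private
  variable
    ℓ : Level
    d n : ℕ

-- Reals are rational Cauchy sequences.  Two sequences denote the same real
-- when x ≤ᵣ y and y ≤ᵣ x; ℝ is not a quotient, but the open sets, closed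
-- sets and boxes defined below all respect this equality.

IsCauchy : (ℕ → ℚ) → Set
IsCauchy x = ∀ ε → 0ℚ ℚ.< ε →
  ∃[ N ] ∀ i j → N ℕ.≤ i → N ℕ.≤ j → ℚ.∣ x i ℚ.- x j ∣ ℚ.≤ ε

record ℝ : Set where
  constructor mkℝ
  field
    seq    : ℕ → ℚ
    cauchy : IsCauchy seq

open ℝ public

module Cauchy where

  half-pos : ∀ {ε} → 0ℚ ℚ.< ε → 0ℚ ℚ.< ε ℚ.* ½
  half-pos {ε} 0<ε =
    ℚₚ.positive⁻¹ (ε ℚ.* ½) {{ℚₚ.pos*pos⇒pos ε {{ℚ.positive 0<ε}} ½}}

  half+half : ∀ ε → ε ℚ.* ½ ℚ.+ ε ℚ.* ½ ≡ ε
  half+half ε = trans (sym (ℚₚ.*-distribˡ-+ ε ½ ½)) (ℚₚ.*-identityʳ ε)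

  p-q+q≡p : ∀ p q → p ℚ.- q ℚ.+ q ≡ p
  p-q+q≡p p q = begin
    p ℚ.- q ℚ.+ q            ≡⟨ ℚₚ.+-assoc p (ℚ.- q) q ⟩
    p ℚ.+ (ℚ.- q ℚ.+ q)      ≡⟨ cong (p ℚ.+_) (ℚₚ.+-inverseˡ q) ⟩
    p ℚ.+ 0ℚ                 ≡⟨ ℚₚ.+-identityʳ p ⟩
    p                        ∎
    where open ≡-Reasoning

  +-diff : ∀ p q r s → (p ℚ.+ q) ℚ.- (r ℚ.+ s) ≡ (p ℚ.- r) ℚ.+ (q ℚ.- s)
  +-diff p q r s = trans
    (cong (p ℚ.+ q ℚ.+_) (ℚₚ.neg-distrib-+ r s))
    (interchange (CommutativeMonoid.commutativeSemigroup ℚₚ.+-0-commutativeMonoid)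
      p q (ℚ.- r) (ℚ.- s))

  *-diff : ∀ p q r s →
    p ℚ.* q ℚ.- r ℚ.* s ≡ p ℚ.* (q ℚ.- s) ℚ.+ (p ℚ.- r) ℚ.* s
  *-diff p q r s = begin
    p ℚ.* q ℚ.- r ℚ.* s
      ≡⟨ cong (ℚ._- r ℚ.* s) (p-q+q≡p (p ℚ.* q) (p ℚ.* s)) ⟨
    p ℚ.* q ℚ.- p ℚ.* s ℚ.+ p ℚ.* s ℚ.- r ℚ.* s
      ≡⟨ ℚₚ.+-assoc (p ℚ.* q ℚ.- p ℚ.* s) (p ℚ.* s) (ℚ.- (r ℚ.* s)) ⟩
    p ℚ.* q ℚ.- p ℚ.* s ℚ.+ (p ℚ.* s ℚ.- r ℚ.* s)
      ≡⟨ cong₂ (λ u v → p ℚ.* q ℚ.+ u ℚ.+ (p ℚ.* s ℚ.+ v))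
           (ℚₚ.neg-distribʳ-* p s) (ℚₚ.neg-distribˡ-* r s) ⟩
    p ℚ.* q ℚ.+ p ℚ.* (ℚ.- s) ℚ.+ (p ℚ.* s ℚ.+ (ℚ.- r) ℚ.* s)
      ≡⟨ cong₂ ℚ._+_ (ℚₚ.*-distribˡ-+ p q (ℚ.- s)) (ℚₚ.*-distribʳ-+ s p (ℚ.- r)) ⟨
    p ℚ.* (q ℚ.- s) ℚ.+ (p ℚ.- r) ℚ.* s ∎
    where open ≡-Reasoning

  *-mono-≤-nonNeg : ∀ {p q r s} → 0ℚ ℚ.≤ q → 0ℚ ℚ.≤ r →
    p ℚ.≤ q → r ℚ.≤ s → p ℚ.* r ℚ.≤ q ℚ.* s
  *-mono-≤-nonNeg {q = q} {r} 0≤q 0≤r p≤q r≤s = ℚₚ.≤-trans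
    (ℚₚ.*-monoʳ-≤-nonNeg r {{ℚ.nonNegative 0≤r}} p≤q)
    (ℚₚ.*-monoˡ-≤-nonNeg q {{ℚ.nonNegative 0≤q}} r≤s)

  eventually-bounded : ∀ x → IsCauchy x →
    ∃₂ λ A N → 0ℚ ℚ.< A × (∀ i → N ℕ.≤ i → ℚ.∣ x i ∣ ℚ.≤ A)
  eventually-bounded x cx = bound (cx 1ℚ (ℚₚ.positive⁻¹ 1ℚ))
    where
    open ℚₚ.≤-Reasoning
    bound : (∃[ N ] ∀ i j → N ℕ.≤ i → N ℕ.≤ j → ℚ.∣ x i ℚ.- x j ∣ ℚ.≤ 1ℚ) →
      ∃₂ λ A N → 0ℚ ℚ.< A × (∀ i → N ℕ.≤ i → ℚ.∣ x i ∣ ℚ.≤ A)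
    bound (N , close) = 1ℚ ℚ.+ ℚ.∣ x N ∣ , N
      , ℚₚ.+-mono-<-≤ (ℚₚ.positive⁻¹ 1ℚ) (ℚₚ.0≤∣p∣ (x N))
      , λ i N≤i → begin
          ℚ.∣ x i ∣                        ≡⟨ cong ℚ.∣_∣ (p-q+q≡p (x i) (x N)) ⟨
          ℚ.∣ x i ℚ.- x N ℚ.+ x N ∣        ≤⟨ ℚₚ.∣p+q∣≤∣p∣+∣q∣ (x i ℚ.- x N) (x N) ⟩
          ℚ.∣ x i ℚ.- x N ∣ ℚ.+ ℚ.∣ x N ∣  ≤⟨ ℚₚ.+-monoˡ-≤ ℚ.∣ x N ∣ (close i N N≤i ℕₚ.≤-refl) ⟩
          1ℚ ℚ.+ ℚ.∣ x N ∣                 ∎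

  split-tolerance : ∀ {A B ε} → 0ℚ ℚ.< A → 0ℚ ℚ.< B → 0ℚ ℚ.< ε →
    ∃[ δ ] 0ℚ ℚ.< δ × A ℚ.* δ ℚ.+ δ ℚ.* B ≡ ε
  split-tolerance {A} {B} {ε} 0<A 0<B 0<ε = δ , 0<δ , eq
    where
    K = A ℚ.+ B
    instance
      _ = ℚ.positive (ℚₚ.+-mono-< 0<A 0<B)
      _ = ℚ.positive 0<ε
      _ = ℚₚ.pos⇒nonZero K
      _ = ℚₚ.1/pos⇒pos K
    δ = ε ℚ.* ℚ.1/ K
    0<δ : 0ℚ ℚ.< δ
    0<δ = ℚₚ.positive⁻¹ δ {{ℚₚ.pos*pos⇒pos ε (ℚ.1/ K)}}
    open ≡-Reasoning
    eq : A ℚ.* δ ℚ.+ δ ℚ.* B ≡ ε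
    eq = begin
      A ℚ.* δ ℚ.+ δ ℚ.* B       ≡⟨ cong (ℚ._+ δ ℚ.* B) (ℚₚ.*-comm A δ) ⟩
      δ ℚ.* A ℚ.+ δ ℚ.* B       ≡⟨ ℚₚ.*-distribˡ-+ δ A B ⟨
      ε ℚ.* ℚ.1/ K ℚ.* K        ≡⟨ ℚₚ.*-assoc ε (ℚ.1/ K) K ⟩
      ε ℚ.* (ℚ.1/ K ℚ.* K)      ≡⟨ cong (ε ℚ.*_) (ℚₚ.*-inverseˡ K) ⟩
      ε ℚ.* 1ℚ                  ≡⟨ ℚₚ.*-identityʳ ε ⟩
      ε                         ∎

  const-cauchy : ∀ q → IsCauchy (λ _ → q)
  const-cauchy q ε 0<ε = 0 , λ _ _ _ _ →
    subst (λ r → ℚ.∣ r ∣ ℚ.≤ ε) (sym (ℚₚ.+-inverseʳ q)) (ℚₚ.<⇒≤ 0<ε)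

  +-cauchy : ∀ x y → IsCauchy x → IsCauchy y → IsCauchy (λ i → x i ℚ.+ y i)
  +-cauchy x y cx cy ε 0<ε
    with cx (ε ℚ.* ½) (half-pos 0<ε) | cy (ε ℚ.* ½) (half-pos 0<ε)
  ... | N , close₁ | M , close₂ = N ℕ.⊔ M , λ i j le₁ le₂ → begin
      ℚ.∣ (x i ℚ.+ y i) ℚ.- (x j ℚ.+ y j) ∣
        ≡⟨ cong ℚ.∣_∣ (+-diff (x i) (y i) (x j) (y j)) ⟩
      ℚ.∣ (x i ℚ.- x j) ℚ.+ (y i ℚ.- y j) ∣
        ≤⟨ ℚₚ.∣p+q∣≤∣p∣+∣q∣ (x i ℚ.- x j) (y i ℚ.- y j) ⟩
      ℚ.∣ x i ℚ.- x j ∣ ℚ.+ ℚ.∣ y i ℚ.- y j ∣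
        ≤⟨ ℚₚ.+-mono-≤
             (close₁ i j (ℕₚ.m⊔n≤o⇒m≤o N M le₁) (ℕₚ.m⊔n≤o⇒m≤o N M le₂))
             (close₂ i j (ℕₚ.m⊔n≤o⇒n≤o N M le₁) (ℕₚ.m⊔n≤o⇒n≤o N M le₂)) ⟩
      ε ℚ.* ½ ℚ.+ ε ℚ.* ½
        ≡⟨ half+half ε ⟩
      ε ∎
    where open ℚₚ.≤-Reasoning

  neg-cauchy : ∀ x → IsCauchy x → IsCauchy (λ i → ℚ.- x i)
  neg-cauchy x cx ε 0<ε with cx ε 0<ε
  ... | N , close = N , λ i j le₁ le₂ → begin
      ℚ.∣ (ℚ.- x i) ℚ.- (ℚ.- x j) ∣   ≡⟨ cong ℚ.∣_∣ (ℚₚ.neg-distrib-+ (x i) (ℚ.- x j)) ⟨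
      ℚ.∣ ℚ.- (x i ℚ.- x j) ∣         ≡⟨ ℚₚ.∣-p∣≡∣p∣ (x i ℚ.- x j) ⟩
      ℚ.∣ x i ℚ.- x j ∣               ≤⟨ close i j le₁ le₂ ⟩
      ε                               ∎
    where open ℚₚ.≤-Reasoning

  *-close : ∀ p q r s {A B δ} → 0ℚ ℚ.< A → 0ℚ ℚ.< δ →
    ℚ.∣ p ∣ ℚ.≤ A → ℚ.∣ s ∣ ℚ.≤ B → ℚ.∣ p ℚ.- r ∣ ℚ.≤ δ → ℚ.∣ q ℚ.- s ∣ ℚ.≤ δ →
    ℚ.∣ p ℚ.* q ℚ.- r ℚ.* s ∣ ℚ.≤ A ℚ.* δ ℚ.+ δ ℚ.* B
  *-close p q r s {A} {B} {δ} 0<A 0<δ p≤A s≤B p-r≤δ q-s≤δ = begin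
    ℚ.∣ p ℚ.* q ℚ.- r ℚ.* s ∣
      ≡⟨ cong ℚ.∣_∣ (*-diff p q r s) ⟩
    ℚ.∣ p ℚ.* (q ℚ.- s) ℚ.+ (p ℚ.- r) ℚ.* s ∣
      ≤⟨ ℚₚ.∣p+q∣≤∣p∣+∣q∣ (p ℚ.* (q ℚ.- s)) ((p ℚ.- r) ℚ.* s) ⟩
    ℚ.∣ p ℚ.* (q ℚ.- s) ∣ ℚ.+ ℚ.∣ (p ℚ.- r) ℚ.* s ∣
      ≡⟨ cong₂ ℚ._+_ (ℚₚ.∣p*q∣≡∣p∣*∣q∣ p (q ℚ.- s)) (ℚₚ.∣p*q∣≡∣p∣*∣q∣ (p ℚ.- r) s) ⟩
    ℚ.∣ p ∣ ℚ.* ℚ.∣ q ℚ.- s ∣ ℚ.+ ℚ.∣ p ℚ.- r ∣ ℚ.* ℚ.∣ s ∣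
      ≤⟨ ℚₚ.+-mono-≤
           (*-mono-≤-nonNeg (ℚₚ.<⇒≤ 0<A) (ℚₚ.0≤∣p∣ (q ℚ.- s)) p≤A q-s≤δ)
           (*-mono-≤-nonNeg (ℚₚ.<⇒≤ 0<δ) (ℚₚ.0≤∣p∣ s) p-r≤δ s≤B) ⟩
    A ℚ.* δ ℚ.+ δ ℚ.* B ∎
    where open ℚₚ.≤-Reasoning

  *-cauchy : ∀ x y → IsCauchy x → IsCauchy y → IsCauchy (λ i → x i ℚ.* y i)
  *-cauchy x y cx cy ε 0<ε =
    let A , N₁ , 0<A , x≤A = eventually-bounded x cx
        B , N₂ , 0<B , y≤B = eventually-bounded y cy
        δ , 0<δ , eq       = split-tolerance 0<A 0<B 0<ε
        N₃ , close₁        = cx δ 0<δ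
        N₄ , close₂        = cy δ 0<δ
        N₁₂ = N₁ ℕ.⊔ N₂
        N₃₄ = N₃ ℕ.⊔ N₄
    in N₁₂ ℕ.⊔ N₃₄ , λ i j le₁ le₂ →
      let i₁₂ = ℕₚ.m⊔n≤o⇒m≤o N₁₂ N₃₄ le₁
          j₁₂ = ℕₚ.m⊔n≤o⇒m≤o N₁₂ N₃₄ le₂
          i₃₄ = ℕₚ.m⊔n≤o⇒n≤o N₁₂ N₃₄ le₁
          j₃₄ = ℕₚ.m⊔n≤o⇒n≤o N₁₂ N₃₄ le₂
      in subst (ℚ.∣ x i ℚ.* y i ℚ.- x j ℚ.* y j ∣ ℚ.≤_) eq
           (*-close (x i) (y i) (x j) (y j) 0<A 0<δ
             (x≤A i (ℕₚ.m⊔n≤o⇒m≤o N₁ N₂ i₁₂))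
             (y≤B j (ℕₚ.m⊔n≤o⇒n≤o N₁ N₂ j₁₂))
             (close₁ i j (ℕₚ.m⊔n≤o⇒m≤o N₃ N₄ i₃₄) (ℕₚ.m⊔n≤o⇒m≤o N₃ N₄ j₃₄))
             (close₂ i j (ℕₚ.m⊔n≤o⇒n≤o N₃ N₄ i₃₄) (ℕₚ.m⊔n≤o⇒n≤o N₃ N₄ j₃₄)))

  abs-cauchy : ∀ x → IsCauchy x → IsCauchy (λ i → ℚ.∣ x i ∣)
  abs-cauchy x cx ε 0<ε with cx ε 0<ε
  ... | N , close = N , λ i j le₁ le₂ → abs≤ (x i) (x j)
      (close i j le₁ le₂) (close j i le₂ le₁)
    where
    open ℚₚ.≤-Reasoning
    diff≤ : ∀ p q → ℚ.∣ p ℚ.- q ∣ ℚ.≤ ε → ℚ.∣ p ∣ ℚ.- ℚ.∣ q ∣ ℚ.≤ ε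
    diff≤ p q le = begin
      ℚ.∣ p ∣ ℚ.- ℚ.∣ q ∣
        ≡⟨ cong (λ r → ℚ.∣ r ∣ ℚ.- ℚ.∣ q ∣) (p-q+q≡p p q) ⟨
      ℚ.∣ p ℚ.- q ℚ.+ q ∣ ℚ.- ℚ.∣ q ∣
        ≤⟨ ℚₚ.+-monoˡ-≤ (ℚ.- ℚ.∣ q ∣) (ℚₚ.∣p+q∣≤∣p∣+∣q∣ (p ℚ.- q) q) ⟩
      ℚ.∣ p ℚ.- q ∣ ℚ.+ ℚ.∣ q ∣ ℚ.- ℚ.∣ q ∣
        ≡⟨ ℚₚ.+-assoc ℚ.∣ p ℚ.- q ∣ ℚ.∣ q ∣ (ℚ.- ℚ.∣ q ∣) ⟩
      ℚ.∣ p ℚ.- q ∣ ℚ.+ (ℚ.∣ q ∣ ℚ.- ℚ.∣ q ∣)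
        ≡⟨ cong (ℚ.∣ p ℚ.- q ∣ ℚ.+_) (ℚₚ.+-inverseʳ ℚ.∣ q ∣) ⟩
      ℚ.∣ p ℚ.- q ∣ ℚ.+ 0ℚ
        ≡⟨ ℚₚ.+-identityʳ ℚ.∣ p ℚ.- q ∣ ⟩
      ℚ.∣ p ℚ.- q ∣
        ≤⟨ le ⟩
      ε ∎
    neg-diff : ∀ p q → ℚ.- (p ℚ.- q) ≡ q ℚ.- p
    neg-diff p q = ⁻¹-anti-homo-// p q
      where open import Algebra.Properties.Group ℚₚ.+-0-group
    abs≤ : ∀ p q → ℚ.∣ p ℚ.- q ∣ ℚ.≤ ε → ℚ.∣ q ℚ.- p ∣ ℚ.≤ ε →
      ℚ.∣ ℚ.∣ p ∣ ℚ.- ℚ.∣ q ∣ ∣ ℚ.≤ ε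
    abs≤ p q le₁ le₂ with ℚₚ.∣p∣≡p∨∣p∣≡-p (ℚ.∣ p ∣ ℚ.- ℚ.∣ q ∣)
    ... | inj₁ eq = subst (ℚ._≤ ε) (sym eq) (diff≤ p q le₁)
    ... | inj₂ eq = subst (ℚ._≤ ε)
      (sym (trans eq (neg-diff ℚ.∣ p ∣ ℚ.∣ q ∣))) (diff≤ q p le₂)

infix  8 -ᵣ_
infixl 7 _*ᵣ_
infixl 6 _+ᵣ_ _-ᵣ_
infix  4 _≤ᵣ_ _<ᵣ_

fromℚ : ℚ → ℝ
fromℚ q = mkℝ (λ _ → q) (Cauchy.const-cauchy q)

0ᵣ 1ᵣ : ℝ
0ᵣ = fromℚ 0ℚ
1ᵣ = fromℚ 1ℚ

_+ᵣ_ : ℝ → ℝ → ℝ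
x +ᵣ y = mkℝ (λ i → seq x i ℚ.+ seq y i) (Cauchy.+-cauchy (seq x) (seq y) (cauchy x) (cauchy y))

_*ᵣ_ : ℝ → ℝ → ℝ
x *ᵣ y = mkℝ (λ i → seq x i ℚ.* seq y i) (Cauchy.*-cauchy (seq x) (seq y) (cauchy x) (cauchy y))

-ᵣ_ : ℝ → ℝ
-ᵣ x = mkℝ (λ i → ℚ.- seq x i) (Cauchy.neg-cauchy (seq x) (cauchy x))

_-ᵣ_ : ℝ → ℝ → ℝ
x -ᵣ y = x +ᵣ (-ᵣ y)

∣_∣ᵣ : ℝ → ℝ
∣ x ∣ᵣ = mkℝ (λ i → ℚ.∣ seq x i ∣) (Cauchy.abs-cauchy (seq x) (cauchy x))

_≤ᵣ_ _<ᵣ_ : ℝ → ℝ → Set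
x ≤ᵣ y = ∀ ε → 0ℚ ℚ.< ε → ∃[ N ] ∀ i → N ℕ.≤ i → seq x i ℚ.≤ seq y i ℚ.+ ε
x <ᵣ y = ∃[ ε ] 0ℚ ℚ.< ε × ∃[ N ] ∀ i → N ℕ.≤ i → seq x i ℚ.+ ε ℚ.≤ seq y i

ℝ^_ : ℕ → Set
ℝ^ d = Vector ℝ d

Region : ℕ → Set₁
Region d = Pred (ℝ^ d) 0ℓ

-- Open ball for the maximum metric, which induces the standard topology.
Ball : ℝ^ d → ℝ → Region d
Ball p ε q = ∀ i → ∣ q i -ᵣ p i ∣ᵣ <ᵣ ε

IsOpen : Region d → Set
IsOpen U = ∀ p → U p → ∃[ ε ] 0ᵣ <ᵣ ε × (∀ q → Ball p ε q → U q)

-- Closedness as containing all adherent points; constructively this is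
-- better behaved than openness of the complement.
IsClosed : Region d → Set
IsClosed U = ∀ p → (∀ ε → 0ᵣ <ᵣ ε → ∃[ q ] Ball p ε q × U q) → U p

IsConvex : Region d → Set
IsConvex U = ∀ p q → U p → U q → ∀ t → 0ᵣ ≤ᵣ t → t ≤ᵣ 1ᵣ →
  U (λ i → (1ᵣ -ᵣ t) *ᵣ p i +ᵣ t *ᵣ q i)

IsBounded : Region d → Set
IsBounded U = ∃[ M ] ∀ p → U p → ∀ i → ∣ p i ∣ᵣ ≤ᵣ M

[_,_]^ : ℝ^ d → ℝ^ d → Region d
[ a , b ]^ p = ∀ i → a i ≤ᵣ p i × p i ≤ᵣ b i

IsBox : Region d → Set
IsBox U = Empty U ⊎ (∃₂ λ a b → (∀ i → a i ≤ᵣ b i) × U ≐ [ a , b ]^)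

-- A subset of the finite set 2^[n] is a decidable predicate on 2^[n]
-- (classically, decidability is no restriction).
record Code (n : ℕ) : Set₁ where
  field
    Word  : Pred (Subset n) 0ℓ
    word? : Decidable Word

open Code public

infixl 7 _⊓_

_⊓_ : Code n → Code n → Code n
Word  (C ⊓ D) σ = ∃₂ λ c₁ c₂ → Word C c₁ × Word D c₂ × σ ≡ c₁ ∩ c₂
word? (C ⊓ D) σ = anySubset? λ c₁ → anySubset? λ c₂ →
  word? C c₁ ×-dec word? D c₂ ×-dec ≡-dec _≟ᵇ_ σ (c₁ ∩ c₂)

code : (Fin n → Region d) → Pred (Subset n) 0ℓ
code U σ = ∃[ p ] ∀ i → U i p ⇔ i ∈ σ

HasRealization : (∀ {d} → Pred (Region d) 0ℓ) → Code n → ℕ → Set₁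
HasRealization {n} Q C d = ∃[ U ]
  (∀ (i : Fin n) → Q (U i) × IsBounded {d} (U i)) × code U ≐ Word C

ℕ∞ : Set
ℕ∞ = ℕ ⁺

infixl 6 _+∞_
infix  4 _≤∞_

_+∞_ : ℕ∞ → ℕ∞ → ℕ∞
[ a ] +∞ [ b ] = [ a ℕ.+ b ]
[ _ ] +∞ ⊤⁺    = ⊤⁺
⊤⁺    +∞ _     = ⊤⁺

_≤∞_ : ℕ∞ → ℕ∞ → Set
_≤∞_ = _≤⁺_

-- "m = min P", with min ∅ = ∞.  Computing min P for undecidable P needs
-- excluded middle, so the minimum is given as a relation; it is functional
-- and, up to double negation, total.
IsMin : Pred ℕ ℓ → ℕ∞ → Set ℓ
IsMin P [ m ] = P m × (∀ k → P k → m ℕ.≤ k)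
IsMin P ⊤⁺    = Empty P

IsMin-unique : ∀ {P : Pred ℕ ℓ} a b → IsMin P a → IsMin P b → a ≡ b
IsMin-unique [ a ] [ b ] (Pa , a≤) (Pb , b≤) = cong [_] (ℕₚ.≤-antisym (a≤ b Pb) (b≤ a Pa))
IsMin-unique [ a ] ⊤⁺    (Pa , _)  ¬P        = contradiction Pa (¬P a)
IsMin-unique ⊤⁺    [ b ] ¬P        (Pb , _)  = contradiction Pb (¬P b)
IsMin-unique ⊤⁺    ⊤⁺    _         _         = refl

IsMin-exists : ∀ (P : Pred ℕ ℓ) → ¬ ¬ (∃[ m ] IsMin P m)
IsMin-exists P none = none (⊤⁺ , <-rec (λ k → ¬ P k) step)
  where
  step : ∀ k → (∀ {j} → j ℕ.< k → ¬ P j) → ¬ P k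
  step k below Pk =
    none ([ k ] , Pk , λ j Pj → ℕₚ.≮⇒≥ (λ j<k → below j<k Pj))

infix 4 odim_is_ cdim_is_ bdim_is_

odim_is_ cdim_is_ bdim_is_ : Code n → ℕ∞ → Set₁
odim C is m = IsMin (HasRealization (λ U → IsOpen U × IsConvex U) C) m
cdim C is m = IsMin (HasRealization (λ U → IsClosed U × IsConvex U) C) m
bdim C is m = IsMin (HasRealization IsBox C) m

-- Realizations U of C in ℝᵃ and V of D in ℝᵇ give the realization U i × V i of
-- C ⊓ D in ℝᵃ⁺ᵇ: the codeword of (p , q) is the intersection of the codewords
-- of p and q.  Two constructive points: deciding which U i contain p is only
-- possible up to double negation, which decidability of C ⊓ D removes; and
-- vectors are functions, so regions have to respect pointwise equality.

{-# OPTIONS --safe #-}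
module Submission where

open import Data.Nat using (ℕ)
open import Data.Product using (_×_)
open import Defs

open import Data.Bool.Base using (true)
open import Data.Fin.Base using (Fin; _↑ˡ_; _↑ʳ_; splitAt; join)
open import Data.Fin.Properties using (sequence; join-splitAt)
open import Data.Fin.Subset using (Subset; _∈_; _∩_)
open import Data.Fin.Subset.Properties using (⊆-antisym; ∩⇔×)
import Data.Nat.Base as ℕ
import Data.Nat.Properties as ℕₚ
open import Data.Product.Base using (∃-syntax; _,_; proj₁; proj₂)
import Data.Product.Base as Product
open import Data.Rational.Base as ℚ using (0ℚ)
import Data.Rational.Properties as ℚₚ
open import Data.Sum.Base using (inj₁; inj₂)
import Data.Sum.Base as Sum
open import Data.Vec.Base using (tabulate)
open import Data.Vec.Functional using (_++_)
open import Data.Vec.Functional.Properties using (lookup-++ˡ; lookup-++ʳ)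
open import Data.Vec.Properties using (lookup∘tabulate; lookup⇒[]=; []=⇒lookup)
open import Effect.Monad using (module RawMonad)
open import Function.Base using (_∘_)
open import Function.Bundles using (_⇔_; mk⇔; module Equivalence)
open import Level using (0ℓ)
open import Relation.Binary.Construct.Add.Supremum.NonStrict ℕ._≤_ using ([_]; _≤⊤⁺)
open import Relation.Binary.PropositionalEquality
  using (_≡_; _≗_; refl; sym; trans; subst; subst₂)
open import Relation.Nullary using (¬_; Dec; does; yes; no; contradiction)
open import Relation.Nullary.Construct.Add.Supremum using (⊤⁺; [_])
open import Relation.Nullary.Decidable using (decidable-stable; dec-true; ¬¬-excluded-middle)
open import Relation.Nullary.Negation using (¬¬-Monad)
open import Relation.Unary using (Pred; _≐_)

open Equivalence using (to; from)

private
  variable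
    a b n : ℕ

-- Products of regions and their coordinates

Extensional : Region a → Set
Extensional U = ∀ {p q} → p ≗ q → U p → U q

infixr 6 _⊠_

_⊠_ : Region a → Region b → Region (a ℕ.+ b)
_⊠_ {a} {b} U V p = U (p ∘ (_↑ˡ b)) × V (p ∘ (a ↑ʳ_))

-- Each index is the `join` of its own `splitAt`, and `join` computes on either injection, so the
-- two given families are exactly the two cases.
↑-cover : {P : Pred (Fin (a ℕ.+ b)) 0ℓ} →
  (∀ i → P (i ↑ˡ b)) → (∀ j → P (a ↑ʳ j)) → ∀ k → P k
↑-cover {a} {b} {P} l r k = subst P (join-splitAt a b k) (on-join (splitAt a k))
  where
  on-join : ∀ s → P (join a b s)
  on-join = Sum.[ l , r ]

-- The two restrictions of `p ++ q` agree with `p` and `q` only pointwise, not definitionally; this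
-- is where extensionality enters.
⊠-++ : {U : Region a} {V : Region b} → Extensional U → Extensional V →
  ∀ p q → (U ⊠ V) (p ++ q) ⇔ (U p × V q)
⊠-++ U-ext V-ext p q = mk⇔
  (Product.map (U-ext (lookup-++ˡ p q)) (V-ext (lookup-++ʳ p q)))
  (Product.map (U-ext (sym ∘ lookup-++ˡ p q)) (V-ext (sym ∘ lookup-++ʳ p q)))

-- Radii of balls, and extensionality of open sets, closed sets and boxes

0<0+ : ∀ {e} → 0ℚ ℚ.< e → 0ᵣ <ᵣ fromℚ e
0<0+ {e} 0<e = e , 0<e , 0 , λ _ _ → ℚₚ.≤-reflexive (ℚₚ.+-identityˡ e)

-- The rational witness `e` of positivity is eventually a lower bound for the sequence of `ε`, so
-- anything below `r ≤ e` stays below `ε` with the same gap `δ`.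
shrink : ∀ {x ε} ((e , _) : 0ᵣ <ᵣ ε) {r} → r ℚ.≤ e → x <ᵣ fromℚ r → x <ᵣ ε
shrink {x} {ε} (e , _ , N , e≤ε) {r} r≤e (δ , 0<δ , M , x+δ≤r) =
  δ , 0<δ , M ℕ.⊔ N , λ i le → begin
    seq x i ℚ.+ δ   ≤⟨ x+δ≤r i (ℕₚ.m⊔n≤o⇒m≤o M N le) ⟩
    r               ≤⟨ r≤e ⟩
    e               ≡⟨ ℚₚ.+-identityˡ e ⟨
    0ℚ ℚ.+ e        ≤⟨ e≤ε i (ℕₚ.m⊔n≤o⇒n≤o M N le) ⟩
    seq ε i         ∎
  where open ℚₚ.≤-Reasoning

-- The minimum is taken of the rational witnesses of positivity, not of the reals `ε` and `δ`; it
-- provides a common radius for two balls.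
<ᵣ-directed : ∀ {ε δ} → 0ᵣ <ᵣ ε → 0ᵣ <ᵣ δ →
  ∃[ η ] 0ᵣ <ᵣ η × (∀ x → x <ᵣ η → x <ᵣ ε × x <ᵣ δ)
<ᵣ-directed {ε} {δ} 0<ε@(e , 0<e , _) 0<δ@(d , 0<d , _) =
  fromℚ (e ℚ.⊓ d) , 0<0+ 0<e⊓d , λ x x<η →
    shrink {x} {ε} 0<ε (ℚₚ.p⊓q≤p e d) x<η , shrink {x} {δ} 0<δ (ℚₚ.p⊓q≤q e d) x<η
  where
  0<e⊓d : 0ℚ ℚ.< e ℚ.⊓ d
  0<e⊓d with ℚₚ.⊓-sel e d
  ... | inj₁ eq = subst (0ℚ ℚ.<_) (sym eq) 0<e
  ... | inj₂ eq = subst (0ℚ ℚ.<_) (sym eq) 0<d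

∣x-x∣<ε : ∀ x {ε} → 0ᵣ <ᵣ ε → ∣ x -ᵣ x ∣ᵣ <ᵣ ε
∣x-x∣<ε x {ε} (e , 0<e , N , e≤ε) = e , 0<e , N , λ i le →
  subst (λ z → ℚ.∣ z ∣ ℚ.+ e ℚ.≤ seq ε i) (sym (ℚₚ.+-inverseʳ (seq x i))) (e≤ε i le)

-- Pointwise equal vectors are at distance zero. Hence an open set, containing a ball around `p`,
-- contains `q`, and a closed set contains `q` because `p` makes it adherent.
≗⇒Ball : ∀ {p q : ℝ^ a} {ε} → p ≗ q → 0ᵣ <ᵣ ε → Ball p ε q
≗⇒Ball {p = p} {ε = ε} p≗q 0<ε i =
  subst (λ x → ∣ x -ᵣ p i ∣ᵣ <ᵣ ε) (p≗q i) (∣x-x∣<ε (p i) {ε} 0<ε)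

IsOpen⇒Extensional : {U : Region a} → IsOpen U → Extensional U
IsOpen⇒Extensional U-open {p} {q} p≗q Up with U-open p Up
... | ε , 0<ε , ball⊆U = ball⊆U q (≗⇒Ball {ε = ε} p≗q 0<ε)

IsClosed⇒Extensional : {U : Region a} → IsClosed U → Extensional U
IsClosed⇒Extensional U-closed {p} {q} p≗q Up =
  U-closed q λ ε 0<ε → p , ≗⇒Ball {ε = ε} (sym ∘ p≗q) 0<ε , Up

IsBox⇒Extensional : {U : Region a} → IsBox U → Extensional U
IsBox⇒Extensional (inj₁ empty) _ Up = contradiction Up (empty _)
IsBox⇒Extensional (inj₂ (l , u , _ , U⊆ , ⊆U)) p≗q Up =
  ⊆U λ i → subst (λ x → l i ≤ᵣ x × x ≤ᵣ u i) (p≗q i) (U⊆ Up i)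

-- Properties preserved by products

⊠-open : {U : Region a} {V : Region b} → IsOpen U → IsOpen V → IsOpen (U ⊠ V)
⊠-open {a} {b} U-open V-open p (Up , Vp)
  with U-open _ Up | V-open _ Vp
... | ε , 0<ε , ball⊆U | δ , 0<δ , ball⊆V
  with <ᵣ-directed {ε} {δ} 0<ε 0<δ
-- In the maximum metric, nearness is a condition on each coordinate, so it restricts to both
-- blocks, where `η` can be replaced by `ε` and by `δ`.
... | η , 0<η , η≤ = η , 0<η , λ q near →
  ball⊆U _ (λ i → proj₁ (η≤ ∣ q (i ↑ˡ b) -ᵣ p (i ↑ˡ b) ∣ᵣ (near (i ↑ˡ b)))) ,
  ball⊆V _ (λ j → proj₂ (η≤ ∣ q (a ↑ʳ j) -ᵣ p (a ↑ʳ j) ∣ᵣ (near (a ↑ʳ j))))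

⊠-closed : {U : Region a} {V : Region b} → IsClosed U → IsClosed V → IsClosed (U ⊠ V)
⊠-closed {a} {b} U-closed V-closed p adherent =
  -- A point of the product near `p` restricts to a point of each factor that is equally near.
  U-closed _ (λ ε 0<ε → Product.map (_∘ (_↑ˡ b)) (Product.map (_∘ (_↑ˡ b)) proj₁) (adherent ε 0<ε)) ,
  V-closed _ (λ ε 0<ε → Product.map (_∘ (a ↑ʳ_)) (Product.map (_∘ (a ↑ʳ_)) proj₂) (adherent ε 0<ε))

⊠-convex : {U : Region a} {V : Region b} → IsConvex U → IsConvex V → IsConvex (U ⊠ V)
⊠-convex {a} {b} U-convex V-convex p q (Up , Vp) (Uq , Vq) t 0≤t t≤1 =
  U-convex (p ∘ (_↑ˡ b)) (q ∘ (_↑ˡ b)) Up Uq t 0≤t t≤1 ,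
  V-convex (p ∘ (a ↑ʳ_)) (q ∘ (a ↑ʳ_)) Vp Vq t 0≤t t≤1

⊠-box : {U : Region a} {V : Region b} → IsBox U → IsBox V → IsBox (U ⊠ V)
⊠-box (inj₁ empty) _            = inj₁ λ p → empty _ ∘ proj₁
⊠-box (inj₂ _)     (inj₁ empty) = inj₁ λ p → empty _ ∘ proj₂
⊠-box {a} {b} {U} {V} (inj₂ (l , u , l≤u , U⊆ , ⊆U)) (inj₂ (l′ , u′ , l′≤u′ , V⊆ , ⊆V)) =
  -- With both factors given by corners, the corners of the product are their concatenations.
  inj₂ (l ++ l′ , u ++ u′ , ++-≤ , (λ {p} → ⊠⊆ {p}) , (λ {p} → ⊆⊠ {p}))
  where
  ++-≤ : ∀ k → (l ++ l′) k ≤ᵣ (u ++ u′) k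
  ++-≤ = ↑-cover {P = λ k → (l ++ l′) k ≤ᵣ (u ++ u′) k}
    (λ i → subst₂ _≤ᵣ_ (sym (lookup-++ˡ l l′ i)) (sym (lookup-++ˡ u u′ i)) (l≤u i))
    (λ j → subst₂ _≤ᵣ_ (sym (lookup-++ʳ l l′ j)) (sym (lookup-++ʳ u u′ j)) (l′≤u′ j))

  ⊠⊆ : ∀ {p} → (U ⊠ V) p → [ l ++ l′ , u ++ u′ ]^ p
  ⊠⊆ {p} (Up , Vp) = ↑-cover {P = λ k → (l ++ l′) k ≤ᵣ p k × p k ≤ᵣ (u ++ u′) k}
    (λ i → subst₂ (λ x y → x ≤ᵣ p (i ↑ˡ b) × p (i ↑ˡ b) ≤ᵣ y)
      (sym (lookup-++ˡ l l′ i)) (sym (lookup-++ˡ u u′ i)) (U⊆ Up i))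
    (λ j → subst₂ (λ x y → x ≤ᵣ p (a ↑ʳ j) × p (a ↑ʳ j) ≤ᵣ y)
      (sym (lookup-++ʳ l l′ j)) (sym (lookup-++ʳ u u′ j)) (V⊆ Vp j))

  ⊆⊠ : ∀ {p} → [ l ++ l′ , u ++ u′ ]^ p → (U ⊠ V) p
  ⊆⊠ {p} within =
    ⊆U (λ i → subst₂ (λ x y → x ≤ᵣ p (i ↑ˡ b) × p (i ↑ˡ b) ≤ᵣ y)
      (lookup-++ˡ l l′ i) (lookup-++ˡ u u′ i) (within (i ↑ˡ b))) ,
    ⊆V (λ j → subst₂ (λ x y → x ≤ᵣ p (a ↑ʳ j) × p (a ↑ʳ j) ≤ᵣ y)
      (lookup-++ʳ l l′ j) (lookup-++ʳ u u′ j) (within (a ↑ʳ j)))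

p≤∣p∣ : ∀ p → p ℚ.≤ ℚ.∣ p ∣
p≤∣p∣ p with ℚₚ.≤-total 0ℚ p
... | inj₁ 0≤p = ℚₚ.≤-reflexive (sym (ℚₚ.0≤p⇒∣p∣≡p 0≤p))
... | inj₂ p≤0 = ℚₚ.≤-trans p≤0 (ℚₚ.0≤∣p∣ p)

≤ᵣ-weaken : ∀ {x y z} → (∀ i → seq y i ℚ.≤ seq z i) → x ≤ᵣ y → x ≤ᵣ z
≤ᵣ-weaken y≤z x≤y ε 0<ε = Product.map₂
  (λ close i N≤i → ℚₚ.≤-trans (close i N≤i) (ℚₚ.+-monoˡ-≤ ε (y≤z i))) (x≤y ε 0<ε)

-- Absolute values because the bound of an empty region may be negative.
⊠-bounded : {U : Region a} {V : Region b} → IsBounded U → IsBounded V → IsBounded (U ⊠ V)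
⊠-bounded (L , U≤L) (M , V≤M) = ∣ L ∣ᵣ +ᵣ ∣ M ∣ᵣ , λ p (Up , Vp) →
  ↑-cover {P = λ k → ∣ p k ∣ᵣ ≤ᵣ ∣ L ∣ᵣ +ᵣ ∣ M ∣ᵣ}
    (λ i → ≤ᵣ-weaken {∣ p _ ∣ᵣ} {L} {∣ L ∣ᵣ +ᵣ ∣ M ∣ᵣ} L≤ (U≤L _ Up i))
    (λ j → ≤ᵣ-weaken {∣ p _ ∣ᵣ} {M} {∣ L ∣ᵣ +ᵣ ∣ M ∣ᵣ} M≤ (V≤M _ Vp j))
  where
  open ℚₚ.≤-Reasoning
  L≤ : ∀ i → seq L i ℚ.≤ ℚ.∣ seq L i ∣ ℚ.+ ℚ.∣ seq M i ∣
  L≤ i = begin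
    seq L i                            ≤⟨ p≤∣p∣ (seq L i) ⟩
    ℚ.∣ seq L i ∣                      ≡⟨ ℚₚ.+-identityʳ _ ⟨
    ℚ.∣ seq L i ∣ ℚ.+ 0ℚ               ≤⟨ ℚₚ.+-monoʳ-≤ ℚ.∣ seq L i ∣ (ℚₚ.0≤∣p∣ (seq M i)) ⟩
    ℚ.∣ seq L i ∣ ℚ.+ ℚ.∣ seq M i ∣    ∎
  M≤ : ∀ i → seq M i ℚ.≤ ℚ.∣ seq L i ∣ ℚ.+ ℚ.∣ seq M i ∣
  M≤ i = begin
    seq M i                            ≤⟨ p≤∣p∣ (seq M i) ⟩
    ℚ.∣ seq M i ∣                      ≡⟨ ℚₚ.+-identityˡ _ ⟨
    0ℚ ℚ.+ ℚ.∣ seq M i ∣               ≤⟨ ℚₚ.+-monoˡ-≤ ℚ.∣ seq M i ∣ (ℚₚ.0≤∣p∣ (seq L i)) ⟩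
    ℚ.∣ seq L i ∣ ℚ.+ ℚ.∣ seq M i ∣    ∎

-- Codewords of products

decidable⇒subset : {P : Pred (Fin n) 0ℓ} → (∀ i → Dec (P i)) → ∃[ σ ] (∀ i → P i ⇔ i ∈ σ)
decidable⇒subset {P = P} P? = tabulate (does ∘ P?) , λ i → mk⇔
  (λ Pi → lookup⇒[]= i _ (trans (lookup∘tabulate _ i) (dec-true (P? i) Pi)))
  (λ i∈ → holds (P? i) (trans (sym (lookup∘tabulate (does ∘ P?) i)) ([]=⇒lookup i∈)))
  where
  holds : ∀ {A : Set} (A? : Dec A) → does A? ≡ true → A
  holds (yes x) _ = x
  holds (no _) ()

-- Each instance of excluded middle holds under double negation, and since `Fin n` is finite,
-- `sequence` collects all of them under a single one.
¬¬-subset : (P : Pred (Fin n) 0ℓ) → ¬ ¬ (∃[ σ ] (∀ i → P i ⇔ i ∈ σ))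
¬¬-subset P = decidable⇒subset <$> sequence rawApplicative (λ _ → ¬¬-excluded-middle)
  where open RawMonad (¬¬-Monad {0ℓ})

-- A subset is determined by its members, and membership on either side amounts to `P i × Q i`.
∩-unique : {P Q : Pred (Fin n) 0ℓ} {σ σ₁ σ₂ : Subset n} →
  (∀ i → P i ⇔ i ∈ σ₁) → (∀ i → Q i ⇔ i ∈ σ₂) → (∀ i → (P i × Q i) ⇔ i ∈ σ) → σ ≡ σ₁ ∩ σ₂
∩-unique P⇔ Q⇔ PQ⇔ = ⊆-antisym
  (λ {i} → from ∩⇔× ∘ Product.map (to (P⇔ i)) (to (Q⇔ i)) ∘ from (PQ⇔ i))
  (λ {i} → to (PQ⇔ i) ∘ Product.map (from (P⇔ i)) (from (Q⇔ i)) ∘ to ∩⇔×)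

code-⊠ : {C D : Code n} {U : Fin n → Region a} {V : Fin n → Region b} →
  (∀ i → Extensional (U i)) → (∀ i → Extensional (V i)) →
  code U ≐ Word C → code V ≐ Word D → code (λ i → U i ⊠ V i) ≐ Word (C ⊓ D)
code-⊠ {n} {a} {b} {C} {D} {U} {V} U-ext V-ext (U⊆C , C⊆U) (V⊆D , D⊆V) = ⊆-dir , ⊇-dir
  where
  open RawMonad (¬¬-Monad {0ℓ})

  ⊆-dir : ∀ {σ} → code (λ i → U i ⊠ V i) σ → Word (C ⊓ D) σ
  -- The goal is decidable, hence stable, so the codewords of the two halves of `p` may be obtained
  -- inside the double-negation monad.
  ⊆-dir {σ} (p , p⇔) = decidable-stable (word? (C ⊓ D) σ) do
    σ₁ , U⇔ ← ¬¬-subset (λ i → U i (p ∘ (_↑ˡ b)))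
    σ₂ , V⇔ ← ¬¬-subset (λ i → V i (p ∘ (a ↑ʳ_)))
    pure (σ₁ , σ₂ , U⊆C (_ , U⇔) , V⊆D (_ , V⇔) , ∩-unique U⇔ V⇔ p⇔)

  ⊇-dir : ∀ {σ} → Word (C ⊓ D) σ → code (λ i → U i ⊠ V i) σ
  ⊇-dir (_ , _ , c₁∈C , c₂∈D , refl) with C⊆U c₁∈C | D⊆V c₂∈D
  ... | p , U⇔ | q , V⇔ = p ++ q , λ i → mk⇔
    (from ∩⇔× ∘ Product.map (to (U⇔ i)) (to (V⇔ i)) ∘ to (⊠-++ (U-ext i) (V-ext i) p q))
    (from (⊠-++ (U-ext i) (V-ext i) p q) ∘ Product.map (from (U⇔ i)) (from (V⇔ i)) ∘ to ∩⇔×)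

-- The dimension bound, uniformly in the kind of region

module _ (Q : ∀ {d} → Pred (Region d) 0ℓ)
  (Q⇒ext : ∀ {d} {U : Region d} → Q U → Extensional U)
  (⊠-Q : ∀ {a b} {U : Region a} {V : Region b} → Q U → Q V → Q (U ⊠ V))
  where

  ⊓-realization : (C D : Code n) →
    HasRealization Q C a → HasRealization Q D b → HasRealization Q (C ⊓ D) (a ℕ.+ b)
  ⊓-realization C D (U , U-good , U≐C) (V , V-good , V≐D) =
    (λ i → U i ⊠ V i) ,
    (λ i → ⊠-Q (proj₁ (U-good i)) (proj₁ (V-good i)) ,
           ⊠-bounded (proj₂ (U-good i)) (proj₂ (V-good i))) ,
    code-⊠ {C = C} {D} (Q⇒ext ∘ proj₁ ∘ U-good) (Q⇒ext ∘ proj₁ ∘ V-good) U≐C V≐D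

  ⊓-dim : (C D : Code n) (a b c : ℕ∞) → IsMin (HasRealization Q (C ⊓ D)) c →
    IsMin (HasRealization Q C) a → IsMin (HasRealization Q D) b → c ≤∞ a +∞ b
  ⊓-dim C D ⊤⁺    b     c     _           _        _        = c ≤⊤⁺
  ⊓-dim C D [ a ] ⊤⁺    c     _           _        _        = c ≤⊤⁺
  -- Here the product realization in dimension `a + b` refutes an infinite minimum; in the next case
  -- it bounds the finite one.
  ⊓-dim C D [ a ] [ b ] ⊤⁺    none        (RC , _) (RD , _) =
    contradiction (⊓-realization C D RC RD) (none (a ℕ.+ b))
  ⊓-dim C D [ a ] [ b ] [ c ] (_ , least) (RC , _) (RD , _) =
    [ least (a ℕ.+ b) (⊓-realization C D RC RD) ]

corollary4 : ∀ (n : ℕ) (C D : Code n) →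
    (∀ (a b c : ℕ∞) → odim (C ⊓ D) is c → odim C is a → odim D is b → c ≤∞ a +∞ b) ×
    (∀ (a b c : ℕ∞) → cdim (C ⊓ D) is c → cdim C is a → cdim D is b → c ≤∞ a +∞ b) ×
    (∀ (a b c : ℕ∞) → bdim (C ⊓ D) is c → bdim C is a → bdim D is b → c ≤∞ a +∞ b)
corollary4 n C D =
  ⊓-dim (λ U → IsOpen U × IsConvex U) (IsOpen⇒Extensional ∘ proj₁)
    (λ (Uo , Uc) (Vo , Vc) → ⊠-open Uo Vo , ⊠-convex Uc Vc) C D ,
  ⊓-dim (λ U → IsClosed U × IsConvex U) (IsClosed⇒Extensional ∘ proj₁)
    (λ (Uo , Uc) (Vo , Vc) → ⊠-closed Uo Vo , ⊠-convex Uc Vc) C D ,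
  ⊓-dim IsBox IsBox⇒Extensional ⊠-box C D
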